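{- Let $G$ be an interval graph with interval representation $\{I_u\}_{u\in V(G)}$. Let $D$ be the digraph with $V(D)=E(G)$ whose arcs are given by the interval nest representation $\{(S_e,T_e)\}_{e\in V(D)}$ where, for $e=uv\in E(G)$, $S_e=I_u\cup I_v$ and $T_e=I_u\cap I_v$; that is, for distinct $e,e'\in E(G)$, $(e,e')$ is an arc of $D$ iff $S_e\cap T_{e'}\neq\emptyset$. Then for any $S\subseteq E(G)$, $S$ is a strong independent set in $D$ if and only if $S$ is a uniquely restricted matching in $G$.
   Context: Graphs are finite, simple, undirected. An interval representation of a graph $G$ is a family $\{I_u\}_{u\in V(G)}$ of closed real intervals with $uv\in E(G)$ iff $I_u\cap I_v\neq\emptyset$ for distinct $u,v$; interval graphs are those having one. (For an edge $uv$, $I_u\cap I_v\ne\emptyset$ so $I_u\cup I_v$ and $I_u\cap I_v$ are intervals.) A matching is a set of pairwise vertex-disjoint edges; it is uniquely restricted if no other matching of $G$ matches exactly the same vertex set. In a digraph, a set $S$ of vertices is a strong independent set if for any two $u,v\in S$, $(u,v)$ or $(v,u)$ is not an arc. -}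

module Defs where

open import Level using (Level; 0ℓ; suc; _⊔_)
import Algebra.Construct.NaturalChoice.Min as Min
import Algebra.Construct.NaturalChoice.Max as Max
open import Axiom.ExcludedMiddle using (ExcludedMiddle)
open import Data.Bool.Base using (Bool; T)
open import Data.Fin.Base using (Fin; _<_)
open import Data.Nat.Base using (ℕ)
open import Data.Product.Base using (∃; _×_; _,_; swap)
open import Data.Rational.Base as ℚ using (ℚ)
import Data.Rational.Properties as ℚ
open import Data.Sum.Base using (_⊎_; inj₁; inj₂; [_,_]′)
open import Function.Base using (_∘_; id)
open import Function.Bundles using (_⇔_; Equivalence)
open import Relation.Binary.Bundles using (DecTotalOrder)
open import Relation.Binary.Core using (Rel)
open import Relation.Binary.Definitions using (Decidable; Irreflexive; Symmetric)
open import Relation.Binary.PropositionalEquality.Core using (_≡_; _≢_; _≗_)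
open import Relation.Nullary.Decidable.Core using (Dec; yes; no; recompute)
open import Relation.Nullary.Negation.Core using (¬_; contradiction)
open import Relation.Unary using (Pred; _∈_; _⊆_; _≐_; _∩_; _∪_; _≬_)

private
  variable
    a ℓ : Level

------------------------------------------------------------------------
-- Graphs, edges and matchings

record Graph : Set₁ where
  infix 4 _~_ _~?_
  field
    order  : ℕ
    _~_    : Rel (Fin order) 0ℓ
    _~?_   : Decidable _~_
    sym    : Symmetric _~_
    irrefl : Irreflexive _≡_ _~_

  Vertex : Set
  Vertex = Fin order

-- An unordered pair of adjacent vertices is listed in increasing order.  As
-- the two proofs are irrelevant, edges with equal ends are equal.

record Edge (G : Graph) : Set where
  constructor edge
  open Graph G
  field
    end₁ end₂  : Vertex
    .ordered   : end₁ < end₂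
    .adjacent  : end₁ ~ end₂

-- Classically, every set of edges of a finite graph is of this form.  Two
-- sets of edges are equal when they are pointwise equal.

EdgeSet : Graph → Set
EdgeSet G = Edge G → Bool

module _ {G : Graph} where
  open Graph G

  ⟦_⟧ₑ : EdgeSet G → Pred (Edge G) 0ℓ
  ⟦ S ⟧ₑ = T ∘ S

  endsOf : Edge G → Pred Vertex 0ℓ
  endsOf e v = v ≡ Edge.end₁ e ⊎ v ≡ Edge.end₂ e

  VertexDisjoint : Rel (Edge G) 0ℓ
  VertexDisjoint e f = ¬ (endsOf e ≬ endsOf f)

  IsMatching : Pred (EdgeSet G) 0ℓ
  IsMatching M = ∀ {e f} → e ∈ ⟦ M ⟧ₑ → f ∈ ⟦ M ⟧ₑ → e ≢ f → VertexDisjoint e f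

  matchedVertices : EdgeSet G → Pred Vertex 0ℓ
  matchedVertices M v = ∃ λ e → e ∈ ⟦ M ⟧ₑ × v ∈ endsOf e

  IsUniquelyRestrictedMatching : Pred (EdgeSet G) 0ℓ
  IsUniquelyRestrictedMatching M =
    IsMatching M ×
    (∀ M′ → IsMatching M′ → matchedVertices M′ ≐ matchedVertices M → M′ ≗ M)

------------------------------------------------------------------------
-- Digraphs

record Digraph (a ℓ : Level) : Set (suc (a ⊔ ℓ)) where
  field
    Vertex : Set a
    Arc    : Rel Vertex ℓ

IsStrongIndependent : ∀ {p} (D : Digraph a ℓ) →
                      Pred (Pred (Digraph.Vertex D) p) (a ⊔ ℓ ⊔ p)
IsStrongIndependent D S =
  ∀ {u v} → u ∈ S → v ∈ S → u ≢ v → ¬ Arc u v ⊎ ¬ Arc v u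
  where open Digraph D

------------------------------------------------------------------------
-- Intervals

-- Only the order of the real line plays a role, so intervals are taken in an
-- arbitrary decidable total order; see `ℝ-decTotalOrder` below for ℝ itself.

module _ {c ℓ₁ ℓ₂} (O : DecTotalOrder c ℓ₁ ℓ₂) where
  open DecTotalOrder O using (Carrier; _≤_; trans; total; totalOrder; ≤-respˡ-≈; ≤-respʳ-≈)

  record Interval : Set (c ⊔ ℓ₂) where
    field
      lower upper : Carrier
      lower≤upper : lower ≤ upper

  ⟦_⟧ᵢ : Interval → Pred Carrier ℓ₂
  ⟦ I ⟧ᵢ x = Interval.lower I ≤ x × x ≤ Interval.upper I

  IsInterval : Pred (Pred Carrier ℓ₂) (c ⊔ ℓ₂)
  IsInterval P = ∃ λ I → P ≐ ⟦ I ⟧ᵢ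

  record IntervalRepresentation (G : Graph) : Set (c ⊔ ℓ₂) where
    open Graph G
    field
      interval : Vertex → Interval
      adjacent⇔overlap : ∀ {u v} → u ≢ v →
                         u ~ v ⇔ (⟦ interval u ⟧ᵢ ≬ ⟦ interval v ⟧ᵢ)

  record IntervalNestRepresentation (V : Set a) : Set (a ⊔ c ⊔ suc ℓ₂) where
    field
      outer inner    : V → Pred Carrier ℓ₂
      outer-interval : ∀ v → IsInterval (outer v)
      inner-interval : ∀ v → IsInterval (inner v)
      inner⊆outer    : ∀ v → inner v ⊆ outer v

  nestDigraph : {V : Set a} → IntervalNestRepresentation V → Digraph a (a ⊔ c ⊔ ℓ₂)
  nestDigraph {V = V} N = record
    { Vertex = V
    ; Arc    = λ u v → u ≢ v × (outer u ≬ inner v)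
    }
    where open IntervalNestRepresentation N

  private
    open Min totalOrder using (_⊓_; x⊓y≤x; x⊓y≤y; x≤y⇒x⊓z≤y; ⊓-sel; ⊓-glb)
    open Max totalOrder using (x≤x⊔y; x≤y⊔x; x≤y⇒x≤y⊔z; ⊔-sel; ⊔-lub)
      renaming (_⊔_ to _∨_)

  ∪-interval : ∀ I J → ⟦ I ⟧ᵢ ≬ ⟦ J ⟧ᵢ → IsInterval (⟦ I ⟧ᵢ ∪ ⟦ J ⟧ᵢ)
  ∪-interval I J (z , (i≤z , z≤i′) , (j≤z , z≤j′)) = hull , to , from
    where
    open Interval I renaming (lower to i; upper to i′; lower≤upper to i≤i′)
    open Interval J renaming (lower to j; upper to j′; lower≤upper to j≤j′)

    hull : Interval
    hull = record
      { lower       = i ⊓ j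
      ; upper       = i′ ∨ j′
      ; lower≤upper = trans (x≤y⇒x⊓z≤y j i≤i′) (x≤x⊔y i′ j′)
      }

    to : ⟦ I ⟧ᵢ ∪ ⟦ J ⟧ᵢ ⊆ ⟦ hull ⟧ᵢ
    to (inj₁ (i≤x , x≤i′)) = trans (x⊓y≤x i j) i≤x , trans x≤i′ (x≤x⊔y i′ j′)
    to (inj₂ (j≤x , x≤j′)) = trans (x⊓y≤y i j) j≤x , trans x≤j′ (x≤y⊔x i′ j′)

    from : ⟦ hull ⟧ᵢ ⊆ ⟦ I ⟧ᵢ ∪ ⟦ J ⟧ᵢ
    from {x} (l≤x , x≤u) with total x z | ⊓-sel i j | ⊔-sel i′ j′
    ... | inj₁ x≤z | inj₁ l≈i | _        = inj₁ (≤-respˡ-≈ l≈i l≤x , trans x≤z z≤i′)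
    ... | inj₁ x≤z | inj₂ l≈j | _        = inj₂ (≤-respˡ-≈ l≈j l≤x , trans x≤z z≤j′)
    ... | inj₂ z≤x | _        | inj₁ u≈i′ = inj₁ (trans i≤z z≤x , ≤-respʳ-≈ u≈i′ x≤u)
    ... | inj₂ z≤x | _        | inj₂ u≈j′ = inj₂ (trans j≤z z≤x , ≤-respʳ-≈ u≈j′ x≤u)

  ∩-interval : ∀ I J → ⟦ I ⟧ᵢ ≬ ⟦ J ⟧ᵢ → IsInterval (⟦ I ⟧ᵢ ∩ ⟦ J ⟧ᵢ)
  ∩-interval I J (z , (i≤z , z≤i′) , (j≤z , z≤j′)) =
      record
        { lower       = i ∨ j
        ; upper       = i′ ⊓ j′
        ; lower≤upper = trans (⊔-lub i≤z j≤z) (⊓-glb z≤i′ z≤j′)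
        }
    , (λ ((i≤x , x≤i′) , (j≤x , x≤j′)) → ⊔-lub i≤x j≤x , ⊓-glb x≤i′ x≤j′)
    , (λ (l≤x , x≤u) →
          (trans (x≤x⊔y i j) l≤x , trans x≤u (x⊓y≤x i′ j′))
        , (trans (x≤y⊔x i j) l≤x , trans x≤u (x⊓y≤y i′ j′)))
    where
    open Interval I renaming (lower to i; upper to i′) using ()
    open Interval J renaming (lower to j; upper to j′) using ()

  module _ {G : Graph} (R : IntervalRepresentation G) where
    open Graph G
    open IntervalRepresentation R

    private
      I : Vertex → Pred Carrier ℓ₂
      I v = ⟦ interval v ⟧ᵢ

      ends-overlap : (e : Edge G) → I (Edge.end₁ e) ≬ I (Edge.end₂ e)
      ends-overlap (edge u v _ u~v) = Equivalence.to (adjacent⇔overlap u≢v) u~v′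
        where
        u~v′ : u ~ v
        u~v′ = recompute (u ~? v) u~v

        u≢v : u ≢ v
        u≢v u≡v = irrefl u≡v u~v′

    edgeNestRepresentation : IntervalNestRepresentation (Edge G)
    edgeNestRepresentation = record
      { outer          = λ e → I (Edge.end₁ e) ∪ I (Edge.end₂ e)
      ; inner          = λ e → I (Edge.end₁ e) ∩ I (Edge.end₂ e)
      ; outer-interval = λ e → ∪-interval (interval (Edge.end₁ e)) (interval (Edge.end₂ e)) (ends-overlap e)
      ; inner-interval = λ e → ∩-interval (interval (Edge.end₁ e)) (interval (Edge.end₂ e)) (ends-overlap e)
      ; inner⊆outer    = λ _ (x∈I , _) → inj₁ x∈I
      }

    edgeNestDigraph : Digraph 0ℓ (c ⊔ ℓ₂)
    edgeNestDigraph = nestDigraph edgeNestRepresentation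

------------------------------------------------------------------------
-- The real line

-- Lower Dedekind cuts.  Constructively these are not the usual reals, but they
-- are used only under excluded middle, where the two notions agree.

record ℝ : Set₁ where
  field
    Below     : Pred ℚ 0ℓ
    inhabited : ∃ λ q → q ∈ Below
    bounded   : ∃ λ q → ¬ q ∈ Below
    lower     : ∀ {p q} → p ℚ.< q → q ∈ Below → p ∈ Below
    open′     : ∀ {p} → p ∈ Below → ∃ λ q → p ℚ.< q × q ∈ Below

ℝ-decTotalOrder : ExcludedMiddle 0ℓ → DecTotalOrder (suc 0ℓ) 0ℓ 0ℓ
ℝ-decTotalOrder em = record
  { Carrier = ℝ
  ; _≈_     = λ x y → Below x ≐ Below y
  ; _≤_     = λ x y → Below x ⊆ Below y
  ; isDecTotalOrder = record
    { isTotalOrder = record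
      { isPartialOrder = record
        { isPreorder = record
          { isEquivalence = record
            { refl  = id , id
            ; sym   = swap
            ; trans = λ (f , f⁻¹) (g , g⁻¹) → g ∘ f , f⁻¹ ∘ g⁻¹
            }
          ; reflexive = λ (f , _) → f
          ; trans     = λ f g → g ∘ f
          }
        ; antisym = _,_
        }
      ; total = total
      }
    ; _≟_  = λ _ _ → em
    ; _≤?_ = λ _ _ → em
    }
  }
  where
  open ℝ

  below : ∀ x {p q} → p ℚ.≤ q → q ∈ Below x → p ∈ Below x
  below x {p} p≤q q∈x with q′ , q<q′ , q′∈x ← open′ x q∈x =
    lower x (ℚ.≤-<-trans p≤q q<q′) q′∈x

  total : ∀ x y → Below x ⊆ Below y ⊎ Below y ⊆ Below x
  total x y with em {∃ λ q → q ∈ Below x × ¬ q ∈ Below y}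
  ... | yes (q , q∈x , q∉y) = inj₂ λ {p} p∈y →
    [ (λ p≤q → below x p≤q q∈x) , (λ q≤p → contradiction (below y q≤p p∈y) q∉y) ]′
      (ℚ.≤-total p q)
  ... | no x⊆y = inj₁ λ {q} q∈x → case-∈ q∈x em
    where
    case-∈ : ∀ {q} → q ∈ Below x → Dec (q ∈ Below y) → q ∈ Below y
    case-∈ _   (yes q∈y) = q∈y
    case-∈ q∈x (no q∉y)  = contradiction (_ , q∈x , q∉y) x⊆y

{-# OPTIONS --safe #-}
-- An exchange replaces two edges ab, cd of a matching by edges ac, bd; it keeps
-- the matched vertices.  Two opposite arcs of D between disjoint edges of S
-- yield an alternating 4-cycle, hence an exchange, so that S is not uniquely
-- restricted.  Conversely, let S be strongly independent and let M be another
-- matching of the same vertices.  Among the vertices on which they differ let w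
-- be the one whose interval ends first, with wx, yz ∈ S and wy, xx′ ∈ M.  Since
-- x and y both contain the upper end of w, strong independence separates x from
-- z, so x ends before y does; then x′, meeting x, meets y as well.  Exchanging
-- wy, xx′ for wx, yx′ in M makes it agree with S at w too.  By induction yx′ ∈ S,
-- so x′ = z, although x meets x′ but not z.
module Submission where

open import Defs
open import Data.Bool.Base using (T)
open import Data.Bool.Properties using (T?; T-≡; ⇔→≡)
open import Data.Empty using (⊥-elim-irr)
open import Data.Fin.Properties using (_≟_; <-cmp; <-asym)
open import Data.List.Base using ([]; _∷_; allFin)
open import Data.List.Membership.DecPropositional using () renaming (_∈?_ to member?)
open import Data.List.Membership.Propositional using () renaming (_∈_ to _∈ˡ_; _∉_ to _∉ˡ_)
open import Data.List.Membership.Propositional.Properties using (∈-allFin)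
open import Data.List.Relation.Binary.Permutation.Propositional using (↭-sym)
open import Data.List.Relation.Binary.Permutation.Propositional.Properties using (∈-resp-↭)
open import Data.List.Relation.Unary.All using (lookup)
open import Data.List.Relation.Unary.AllPairs using (AllPairs; []; _∷_)
open import Data.List.Relation.Unary.Any using (here; there)
open import Data.List.Relation.Unary.Linked.Properties using (Linked⇒AllPairs)
import Data.List.Sort as Sort
open import Data.Product.Base using (∃; _×_; _,_; proj₁)
open import Data.Sum.Base using (_⊎_; inj₁; inj₂; swap; [_,_]′)
open import Function.Base using (_∘_; id)
open import Function.Bundles using (_⇔_; mk⇔; Equivalence)
open import Function.Construct.Composition using (_⇔-∘_)
open import Function.Construct.Symmetry using (⇔-sym)
open import Relation.Binary.Bundles using (DecTotalOrder)
import Relation.Binary.Construct.On as On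
open import Relation.Binary.Definitions using (DecidableEquality; tri<; tri≈; tri>)
open import Relation.Binary.PropositionalEquality using (_≡_; _≢_; _≗_; refl; sym; subst; ≢-sym)
open import Relation.Nullary.Decidable
  using (Dec; yes; no; ⌊_⌋; ¬?; _×-dec_; _⊎-dec_; toWitness; fromWitness; recompute; decidable-stable)
open import Relation.Nullary.Negation using (¬_; contradiction)
open import Relation.Unary using (_∈_; _⊆_; _≐_; _∪_; _≬_)

-- Edges of a graph and their ends.

module GraphEdges (G : Graph) where
  open Graph G renaming (sym to ~-sym)

  -- The ends of an edge are stored in increasing order; `Joins` lets an edge be traversed from
  -- either end.
  data Joins (e : Edge G) : Vertex → Vertex → Set where
    forwards  : Joins e (Edge.end₁ e) (Edge.end₂ e)
    backwards : Joins e (Edge.end₂ e) (Edge.end₁ e)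

  Joins-sym : ∀ {e u v} → Joins e u v → Joins e v u
  Joins-sym forwards  = backwards
  Joins-sym backwards = forwards

  Joins⇒∈ˡ : ∀ {e u v} → Joins e u v → u ∈ endsOf e
  Joins⇒∈ˡ forwards  = inj₁ refl
  Joins⇒∈ˡ backwards = inj₂ refl

  Joins⇒∈ʳ : ∀ {e u v} → Joins e u v → v ∈ endsOf e
  Joins⇒∈ʳ = Joins⇒∈ˡ ∘ Joins-sym

  ends-Joins : ∀ {e u v w} → Joins e u v → w ∈ endsOf e → w ≡ u ⊎ w ≡ v
  ends-Joins forwards = id
  ends-Joins backwards = swap

  otherEnd : ∀ e {u} → u ∈ endsOf e → ∃ (Joins e u)
  otherEnd _ (inj₁ refl) = _ , forwards
  otherEnd _ (inj₂ refl) = _ , backwards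

  ends-adjacent : ∀ (e : Edge G) → Edge.end₁ e ~ Edge.end₂ e
  ends-adjacent (edge u v _ u~v) = recompute (u ~? v) u~v

  Joins⇒~ : ∀ {e u v} → Joins e u v → u ~ v
  Joins⇒~ {e} forwards = ends-adjacent e
  Joins⇒~ {e} backwards = ~-sym (ends-adjacent e)

  ~⇒≢ : ∀ {u v} → u ~ v → u ≢ v
  ~⇒≢ u~v u≡v = irrefl u≡v u~v

  ~⇒Joins : ∀ {u v} → u ~ v → ∃ λ e → Joins e u v
  ~⇒Joins {u} {v} u~v with <-cmp u v
  ... | tri< u<v _ _ = edge u v u<v u~v , forwards
  ... | tri≈ _ u≡v _ = contradiction u~v (irrefl u≡v)
  ... | tri> _ _ v<u = edge v u v<u (~-sym u~v) , backwards

  Joins-injective : ∀ {e f u v} → Joins e u v → Joins f u v → e ≡ f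
  Joins-injective forwards forwards = refl
  Joins-injective backwards backwards = refl
  -- Opposite orientations would make the same two ends increasing both ways; the irrelevant order
  -- proofs suffice for this contradiction.
  Joins-injective {edge u v u<v _} {edge _ _ v<u _} forwards backwards =
    ⊥-elim-irr (<-asym u<v v<u)
  Joins-injective {edge u v u<v _} {edge _ _ v<u _} backwards forwards =
    ⊥-elim-irr (<-asym u<v v<u)

  infix 4 _≟ₑ_
  _≟ₑ_ : DecidableEquality (Edge G)
  edge u v _ _ ≟ₑ edge u′ v′ _ _ with u ≟ u′ | v ≟ v′
  ... | yes refl | yes refl = yes refl
  ... | yes _    | no v≢v′  = no λ { refl → v≢v′ refl }
  ... | no u≢u′  | _        = no λ { refl → u≢u′ refl }

  matching-unique : ∀ {M : EdgeSet G} → IsMatching M → ∀ {e f v} →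
                    e ∈ ⟦ M ⟧ₑ → f ∈ ⟦ M ⟧ₑ → v ∈ endsOf e → v ∈ endsOf f → e ≡ f
  matching-unique mat {e} {f} e∈M f∈M v∈e v∈f =
    decidable-stable (e ≟ₑ f) λ e≢f → mat e∈M f∈M e≢f (_ , v∈e , v∈f)

  -- Exchanging two edges of a matching.

  module Exchange (M : EdgeSet G) (e f g h : Edge G) where

    Exchanged : Edge G → Set
    Exchanged k = k ≡ g ⊎ k ≡ h ⊎ (k ∈ ⟦ M ⟧ₑ × k ≢ e × k ≢ f)

    exchanged? : ∀ k → Dec (Exchanged k)
    exchanged? k =
      (k ≟ₑ g) ⊎-dec ((k ≟ₑ h) ⊎-dec (T? (M k) ×-dec (¬? (k ≟ₑ e) ×-dec ¬? (k ≟ₑ f))))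

    exchange : EdgeSet G
    exchange k = ⌊ exchanged? k ⌋

    ∈-exchange⁻ : ∀ {k} → k ∈ ⟦ exchange ⟧ₑ → Exchanged k
    ∈-exchange⁻ {k} = toWitness {a? = exchanged? k}

    ∈-exchange⁺ : ∀ {k} → Exchanged k → k ∈ ⟦ exchange ⟧ₑ
    ∈-exchange⁺ {k} = fromWitness {a? = exchanged? k}

    module _ (mat : IsMatching M) (e∈M : e ∈ ⟦ M ⟧ₑ) (f∈M : f ∈ ⟦ M ⟧ₑ) (e≢f : e ≢ f)
             {a b c d} (e-ab : Joins e a b) (f-cd : Joins f c d)
             (g-ac : Joins g a c) (h-bd : Joins h b d) where

      private
        new⊆old : endsOf g ∪ endsOf h ⊆ endsOf e ∪ endsOf f
        new⊆old (inj₁ v∈g) with ends-Joins g-ac v∈g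
        ... | inj₁ refl = inj₁ (Joins⇒∈ˡ e-ab)
        ... | inj₂ refl = inj₂ (Joins⇒∈ˡ f-cd)
        new⊆old (inj₂ v∈h) with ends-Joins h-bd v∈h
        ... | inj₁ refl = inj₁ (Joins⇒∈ʳ e-ab)
        ... | inj₂ refl = inj₂ (Joins⇒∈ʳ f-cd)

        old⊆new : endsOf e ∪ endsOf f ⊆ endsOf g ∪ endsOf h
        old⊆new (inj₁ v∈e) with ends-Joins e-ab v∈e
        ... | inj₁ refl = inj₁ (Joins⇒∈ˡ g-ac)
        ... | inj₂ refl = inj₂ (Joins⇒∈ˡ h-bd)
        old⊆new (inj₂ v∈f) with ends-Joins f-cd v∈f
        ... | inj₁ refl = inj₁ (Joins⇒∈ʳ g-ac)
        ... | inj₂ refl = inj₂ (Joins⇒∈ʳ h-bd)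

        disjoint-ef : VertexDisjoint e f
        disjoint-ef = mat e∈M f∈M e≢f

        disjoint-gh : VertexDisjoint g h
        disjoint-gh (v , v∈g , v∈h) with ends-Joins g-ac v∈g | ends-Joins h-bd v∈h
        ... | inj₁ refl | inj₁ a≡b  = ~⇒≢ (Joins⇒~ e-ab) a≡b
        ... | inj₁ refl | inj₂ refl = disjoint-ef (_ , Joins⇒∈ˡ e-ab , Joins⇒∈ʳ f-cd)
        ... | inj₂ refl | inj₁ refl = disjoint-ef (_ , Joins⇒∈ʳ e-ab , Joins⇒∈ˡ f-cd)
        ... | inj₂ refl | inj₂ c≡d  = ~⇒≢ (Joins⇒~ f-cd) c≡d

        -- Each end of a new edge is an end of `e` or `f`, which the other edges of the matching
        -- avoid.
        disjoint-new : ∀ {k v} → k ∈ ⟦ M ⟧ₑ × k ≢ e × k ≢ f →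
                       v ∈ endsOf k → ¬ v ∈ endsOf g ∪ endsOf h
        disjoint-new (k∈M , k≢e , k≢f) v∈k v∈gh with new⊆old v∈gh
        ... | inj₁ v∈e = mat k∈M e∈M k≢e (_ , v∈k , v∈e)
        ... | inj₂ v∈f = mat k∈M f∈M k≢f (_ , v∈k , v∈f)

      exchange-matching : IsMatching exchange
      exchange-matching k∈ l∈ k≢l (v , v∈k , v∈l) with ∈-exchange⁻ k∈ | ∈-exchange⁻ l∈
      ... | inj₁ refl        | inj₁ refl        = k≢l refl
      ... | inj₁ refl        | inj₂ (inj₁ refl) = disjoint-gh (v , v∈k , v∈l)
      ... | inj₁ refl        | inj₂ (inj₂ old)  = disjoint-new old v∈l (inj₁ v∈k)
      ... | inj₂ (inj₁ refl) | inj₁ refl        = disjoint-gh (v , v∈l , v∈k)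
      ... | inj₂ (inj₁ refl) | inj₂ (inj₁ refl) = k≢l refl
      ... | inj₂ (inj₁ refl) | inj₂ (inj₂ old)  = disjoint-new old v∈l (inj₂ v∈k)
      ... | inj₂ (inj₂ old)  | inj₁ refl        = disjoint-new old v∈k (inj₁ v∈l)
      ... | inj₂ (inj₂ old)  | inj₂ (inj₁ refl) = disjoint-new old v∈k (inj₂ v∈l)
      ... | inj₂ (inj₂ (k∈M , _)) | inj₂ (inj₂ (l∈M , _)) = mat k∈M l∈M k≢l (v , v∈k , v∈l)

      exchange-matched : matchedVertices exchange ≐ matchedVertices M
      exchange-matched = to , from
        where
        to-old : ∀ {v} → v ∈ endsOf e ∪ endsOf f → v ∈ matchedVertices M
        to-old (inj₁ v∈e) = e , e∈M , v∈e
        to-old (inj₂ v∈f) = f , f∈M , v∈f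

        to-new : ∀ {v} → v ∈ endsOf g ∪ endsOf h → v ∈ matchedVertices exchange
        to-new (inj₁ v∈g) = g , ∈-exchange⁺ (inj₁ refl) , v∈g
        to-new (inj₂ v∈h) = h , ∈-exchange⁺ (inj₂ (inj₁ refl)) , v∈h

        to : matchedVertices exchange ⊆ matchedVertices M
        to (k , k∈ , v∈k) with ∈-exchange⁻ k∈
        ... | inj₁ refl             = to-old (new⊆old (inj₁ v∈k))
        ... | inj₂ (inj₁ refl)      = to-old (new⊆old (inj₂ v∈k))
        ... | inj₂ (inj₂ (k∈M , _)) = k , k∈M , v∈k

        from : matchedVertices M ⊆ matchedVertices exchange
        from (k , k∈M , v∈k) with k ≟ₑ e | k ≟ₑ f
        ... | yes refl | _        = to-new (old⊆new (inj₁ v∈k))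
        ... | no _     | yes refl = to-new (old⊆new (inj₂ v∈k))
        ... | no k≢e   | no k≢f   = k , ∈-exchange⁺ (inj₂ (inj₂ (k∈M , k≢e , k≢f))) , v∈k

  -- Otherwise the exchange along the cycle a, b, d, c matches the same vertices, so it equals `M`
  -- and contains `g`. Then `g` and `e` share a, hence coincide, and c lies on both `e` and `f`.
  uniquelyRestricted⇒¬alternating :
    ∀ {M : EdgeSet G} → IsUniquelyRestrictedMatching M →
    ∀ {e f} → e ∈ ⟦ M ⟧ₑ → f ∈ ⟦ M ⟧ₑ → e ≢ f →
    ∀ {a b c d} → Joins e a b → Joins f c d → a ~ c → ¬ b ~ d
  uniquelyRestricted⇒¬alternating {M} (mat , unique) {e} {f} e∈M f∈M e≢f e-ab f-cd a~c b~d
    with g , g-ac ← ~⇒Joins a~c | h , h-bd ← ~⇒Joins b~d =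
      mat e∈M f∈M e≢f (_ , c∈e , Joins⇒∈ˡ f-cd)
    where
    open Exchange M e f g h

    g∈M : g ∈ ⟦ M ⟧ₑ
    g∈M = subst T
      (unique exchange
        (exchange-matching mat e∈M f∈M e≢f e-ab f-cd g-ac h-bd)
        (exchange-matched mat e∈M f∈M e≢f e-ab f-cd g-ac h-bd) g)
      (∈-exchange⁺ (inj₁ refl))

    c∈e : _ ∈ endsOf e
    c∈e = subst (λ k → _ ∈ endsOf k)
      (matching-unique mat g∈M e∈M (Joins⇒∈ˡ g-ac) (Joins⇒∈ˡ e-ab)) (Joins⇒∈ʳ g-ac)

  -- The edge of `M` at an end of a given edge of `N` lies in `N` too, so it is that edge.
  matching-⊆⇒≗ : ∀ {M N : EdgeSet G} → IsMatching N → matchedVertices M ≐ matchedVertices N →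
                 ⟦ M ⟧ₑ ⊆ ⟦ N ⟧ₑ → M ≗ N
  matching-⊆⇒≗ {M} {N} matN (_ , N⊆M) M⊆N e =
    ⇔→≡ (T-≡ ⇔-∘ (mk⇔ M⊆N from ⇔-∘ ⇔-sym T-≡))
    where
    from : e ∈ ⟦ N ⟧ₑ → e ∈ ⟦ M ⟧ₑ
    from e∈N with k , k∈M , v∈k ← N⊆M (e , e∈N , inj₁ refl) =
      subst ⟦ M ⟧ₑ (matching-unique matN (M⊆N k∈M) e∈N v∈k (inj₁ refl)) k∈M

-- Intervals, adjacency and arcs.

module _ {c ℓ₁ ℓ₂} (O : DecTotalOrder c ℓ₁ ℓ₂) {G : Graph} (R : IntervalRepresentation O G) where
  open DecTotalOrder O using (Carrier; _≤_; total) renaming (trans to ≤-trans; refl to ≤-refl)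
  open Graph G renaming (sym to ~-sym)
  open GraphEdges G
  open IntervalRepresentation R
  open IntervalNestRepresentation (edgeNestRepresentation O R) using (inner; outer; inner-interval)
  open Digraph (edgeNestDigraph O R) using (Arc)

  private
    variable
      u v w x y z : Vertex
      e f : Edge G
      S : EdgeSet G
      p : Carrier

    lower upper : Vertex → Carrier
    lower v = Interval.lower (interval v)
    upper v = Interval.upper (interval v)

    I : Vertex → Carrier → Set _
    I v = ⟦_⟧ᵢ O (interval v)

    upper-∈ : ∀ v → upper v ∈ I v
    upper-∈ v = Interval.lower≤upper (interval v) , ≤-refl

    lower-∈ : ∀ v → lower v ∈ I v
    lower-∈ v = ≤-refl , Interval.lower≤upper (interval v)

  ~⇒lower≤upper : u ~ v → lower u ≤ upper v
  ~⇒lower≤upper u~v with _ , (u≤p , _) , (_ , p≤v) ← Equivalence.to (adjacent⇔overlap (~⇒≢ u~v)) u~v =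
    ≤-trans u≤p p≤v

  common-point⇒~ : u ≢ v → p ∈ I u → p ∈ I v → u ~ v
  common-point⇒~ u≢v p∈u p∈v = Equivalence.from (adjacent⇔overlap u≢v) (_ , p∈u , p∈v)

  -- The larger of the two lower ends lies in both intervals.
  lower≤upper⇒~ : u ≢ v → lower u ≤ upper v → lower v ≤ upper u → u ~ v
  lower≤upper⇒~ {u} {v} u≢v u≤v v≤u with total (lower u) (lower v)
  ... | inj₁ l≤l = common-point⇒~ u≢v (l≤l , v≤u) (lower-∈ v)
  ... | inj₂ l≤l = common-point⇒~ u≢v (lower-∈ u) (l≤l , u≤v)

  inner-Joins⁻ : Joins e u v → p ∈ inner e → p ∈ I u × p ∈ I v
  inner-Joins⁻ forwards (p∈u , p∈v) = p∈u , p∈v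
  inner-Joins⁻ backwards (p∈v , p∈u) = p∈u , p∈v

  inner-Joins⁺ : Joins e u v → p ∈ I u → p ∈ I v → p ∈ inner e
  inner-Joins⁺ forwards p∈u p∈v = p∈u , p∈v
  inner-Joins⁺ backwards p∈u p∈v = p∈v , p∈u

  outer-∈⁺ : ∀ e → v ∈ endsOf e → p ∈ I v → p ∈ outer e
  outer-∈⁺ _ (inj₁ refl) = inj₁
  outer-∈⁺ _ (inj₂ refl) = inj₂

  inner-inhabited : ∀ e → ∃ (inner e)
  inner-inhabited e with J , _ , J⊆inner ← inner-interval e =
    Interval.lower J , J⊆inner (≤-refl , Interval.lower≤upper J)

  -- Any point of `inner f` lies in the interval of the shared end, hence in `outer e`.
  sharedEnd⇒Arc : e ≢ f → v ∈ endsOf e → v ∈ endsOf f → Arc e f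
  sharedEnd⇒Arc {e} {f} e≢f v∈e v∈f
    with p , p∈f ← inner-inhabited f | _ , f-vu ← otherEnd f v∈f =
    e≢f , p , outer-∈⁺ e v∈e (proj₁ (inner-Joins⁻ f-vu p∈f)) , p∈f

  DominatedBy : Edge G → Vertex → Set
  DominatedBy f u = u ~ Edge.end₁ f × u ~ Edge.end₂ f

  -- For disjoint edges this is `Arc` read off the graph, where it is decidable.
  Dominates : Edge G → Edge G → Set
  Dominates e f = DominatedBy f (Edge.end₁ e) ⊎ DominatedBy f (Edge.end₂ e)

  dominates? : ∀ e f → Dec (Dominates e f)
  dominates? e f = dominatedBy? (Edge.end₁ e) ⊎-dec dominatedBy? (Edge.end₂ e)
    where
    dominatedBy? : ∀ u → Dec (DominatedBy f u)
    dominatedBy? u = (u ~? Edge.end₁ f) ×-dec (u ~? Edge.end₂ f)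

  -- A point witnessing the arc lies in the interval of one end of `e` and of both ends of `f`;
  -- disjointness makes these vertices distinct, so overlap means adjacency.
  Arc⇒Dominates : VertexDisjoint e f → Arc e f → Dominates e f
  Arc⇒Dominates {e} {f} e#f (_ , p , p∈e , p∈f₁ , p∈f₂) =
    [ inj₁ ∘ dominatedBy (inj₁ refl) , inj₂ ∘ dominatedBy (inj₂ refl) ]′ p∈e
    where
    dominatedBy : u ∈ endsOf e → p ∈ I u → DominatedBy f u
    dominatedBy u∈e p∈u =
        common-point⇒~ (λ { refl → e#f (_ , u∈e , inj₁ refl) }) p∈u p∈f₁
      , common-point⇒~ (λ { refl → e#f (_ , u∈e , inj₂ refl) }) p∈u p∈f₂

  Dominates⇒~ : ∀ e f → Dominates e f → ∃ λ u → u ∈ endsOf e × (∀ {v} → v ∈ endsOf f → u ~ v)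
  Dominates⇒~ _ _ (inj₁ (u~f₁ , u~f₂)) = _ , inj₁ refl , λ { (inj₁ refl) → u~f₁ ; (inj₂ refl) → u~f₂ }
  Dominates⇒~ _ _ (inj₂ (u~f₁ , u~f₂)) = _ , inj₂ refl , λ { (inj₁ refl) → u~f₁ ; (inj₂ refl) → u~f₂ }

  uniquelyRestricted⇒strongIndependent :
    IsUniquelyRestrictedMatching S → IsStrongIndependent (edgeNestDigraph O R) ⟦ S ⟧ₑ
  uniquelyRestricted⇒strongIndependent urm@(mat , _) {e} {f} e∈S f∈S e≢f
    with dominates? e f | dominates? f e
  ... | no ¬ef | _      = inj₁ (¬ef ∘ Arc⇒Dominates (mat e∈S f∈S e≢f))
  ... | yes _  | no ¬fe = inj₂ (¬fe ∘ Arc⇒Dominates (mat f∈S e∈S (≢-sym e≢f)))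
  -- Here a is adjacent to both ends of `f` and c to both ends of `e`, so a ~ d and b ~ c close an
  -- alternating 4-cycle.
  ... | yes ef | yes fe
    with a , a∈e , a~f ← Dominates⇒~ e f ef | c , c∈f , c~e ← Dominates⇒~ f e fe
    with b , e-ab ← otherEnd e a∈e | d , f-cd ← otherEnd f c∈f =
    contradiction (~-sym (c~e (Joins⇒∈ʳ e-ab)))
      (uniquelyRestricted⇒¬alternating urm e∈S f∈S e≢f e-ab (Joins-sym f-cd) (a~f (Joins⇒∈ʳ f-cd)))

  -- From strong independence to unique restriction.

  module _ (S : EdgeSet G) (independent : IsStrongIndependent (edgeNestDigraph O R) ⟦ S ⟧ₑ) where

    strongIndependent⇒¬biarc : e ∈ ⟦ S ⟧ₑ → f ∈ ⟦ S ⟧ₑ → e ≢ f → Arc e f → ¬ Arc f e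
    strongIndependent⇒¬biarc e∈S f∈S e≢f ef fe =
      [ contradiction ef , contradiction fe ]′ (independent e∈S f∈S e≢f)

    strongIndependent⇒matching : IsMatching S
    strongIndependent⇒matching e∈S f∈S e≢f (_ , v∈e , v∈f) =
      strongIndependent⇒¬biarc e∈S f∈S e≢f (sharedEnd⇒Arc e≢f v∈e v∈f)
        (sharedEnd⇒Arc (≢-sym e≢f) v∈f v∈e)

    -- If `x ~ z`, both arcs would exist: `upper w` witnesses the one from `f` to `e`, and `arc-ef`
    -- is the other.
    strongIndependent⇒≁ : e ∈ ⟦ S ⟧ₑ → f ∈ ⟦ S ⟧ₑ → e ≢ f → Joins e w x → Joins f y z →
                          upper w ∈ I x → upper w ∈ I y → upper w ≤ upper z → ¬ x ~ z
    strongIndependent⇒≁ {e} {f} {w} {x} {y} {z} e∈S f∈S e≢f e-wx f-yz w∈x w∈y w≤z x~z =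
      strongIndependent⇒¬biarc e∈S f∈S e≢f (e≢f , arc-ef)
        (≢-sym e≢f , _ , outer-∈⁺ f (Joins⇒∈ˡ f-yz) w∈y , inner-Joins⁺ e-wx (upper-∈ w) w∈x)
      where
      arc-ef : outer e ≬ inner f
      arc-ef with total (lower z) (upper w)
      ... | inj₁ z≤w =
        _ , outer-∈⁺ e (Joins⇒∈ʳ e-wx) w∈x , inner-Joins⁺ f-yz w∈y (z≤w , w≤z)
      -- Now `z` begins at or after the upper end of `w`, and `lower z` lies in `x` and `y` because
      -- `z` meets both.
      ... | inj₂ w≤z′ =
        _ , outer-∈⁺ e (Joins⇒∈ʳ e-wx) (≤-trans (proj₁ w∈x) w≤z′ , ~⇒lower≤upper (~-sym x~z))
          , inner-Joins⁺ f-yz (≤-trans (proj₁ w∈y) w≤z′ , ~⇒lower≤upper (~-sym (Joins⇒~ f-yz))) (lower-∈ z)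

    IsRival : EdgeSet G → Set
    IsRival M = IsMatching M × matchedVertices M ≐ matchedVertices S

    -- Although one-sided, for a rival `M` this says that `M` and `S` match `v` by the same edge or
    -- both leave it unmatched.
    AgreesAt : EdgeSet G → Vertex → Set
    AgreesAt M v = ∀ {e} → e ∈ ⟦ M ⟧ₑ → v ∈ endsOf e → e ∈ ⟦ S ⟧ₑ

    -- All disagreements lie in `w ∷ vs`. The induction hypothesis `rec` ranges over every rival,
    -- since it is applied to the exchanged matching and not to `M`.
    leftmost-agrees :
      ∀ {w vs} → (∀ {v} → v ∈ˡ w ∷ vs → upper w ≤ upper v) →
      (∀ {M} → IsRival M → (∀ {v} → v ∉ˡ vs → AgreesAt M v) → ⟦ M ⟧ₑ ⊆ ⟦ S ⟧ₑ) →
      ∀ {M} → IsRival M → (∀ {v} → v ∉ˡ w ∷ vs → AgreesAt M v) → AgreesAt M w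
    leftmost-agrees {w} {vs} w-min rec {M} (matM , M⊆S , S⊆M) agrees {e} e∈M w∈e =
      decidable-stable (T? (S e)) impossible
      where
      matS = strongIndependent⇒matching

      disagrees⇒∈ : ∀ {k v} → k ∈ ⟦ M ⟧ₑ → ¬ k ∈ ⟦ S ⟧ₑ → v ∈ endsOf k → v ∈ˡ w ∷ vs
      disagrees⇒∈ {v = v} k∈M k∉S v∈k =
        decidable-stable (member? _≟_ v (w ∷ vs)) λ v∉ → k∉S (agrees v∉ k∈M v∈k)

      impossible : ¬ ¬ e ∈ ⟦ S ⟧ₑ
      impossible e∉S
        -- The edges `e` = wy, `f` = xx′ and `l` at z come from `M`; `g` = wx and `k` = yz come from
        -- `S`.
        with y , e-wy ← otherEnd e w∈e
        with g , g∈S , w∈g ← M⊆S (e , e∈M , w∈e)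
        with x , g-wx ← otherEnd g w∈g
        with f , f∈M , x∈f ← S⊆M (g , g∈S , Joins⇒∈ʳ g-wx)
        with x′ , f-xx′ ← otherEnd f x∈f
        with k , k∈S , y∈k ← M⊆S (e , e∈M , Joins⇒∈ʳ e-wy)
        with z , k-yz ← otherEnd k y∈k
        with l , l∈M , z∈l ← S⊆M (k , k∈S , Joins⇒∈ʳ k-yz)
        = x≁z (subst (x ~_) (x′≡z (~⇒Joins y~x′)) (Joins⇒~ f-xx′))
        where
        e≢f : e ≢ f
        e≢f refl = e∉S (subst ⟦ S ⟧ₑ g≡e g∈S)
          where
          g≡e : g ≡ e
          g≡e with ends-Joins e-wy x∈f
          ... | inj₁ x≡w  = contradiction (sym x≡w) (~⇒≢ (Joins⇒~ g-wx))
          ... | inj₂ refl = Joins-injective g-wx e-wy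

        w∉f : ¬ w ∈ endsOf f
        w∉f w∈f = matM e∈M f∈M e≢f (w , w∈e , w∈f)

        g≢f : g ≢ f
        g≢f refl = w∉f w∈g

        f∉S : ¬ f ∈ ⟦ S ⟧ₑ
        f∉S f∈S = matS g∈S f∈S g≢f (x , Joins⇒∈ʳ g-wx , x∈f)

        x≢y : x ≢ y
        x≢y refl = matM e∈M f∈M e≢f (x , Joins⇒∈ʳ e-wy , x∈f)

        g≢k : g ≢ k
        g≢k refl with ends-Joins g-wx y∈k
        ... | inj₁ y≡w = ~⇒≢ (Joins⇒~ e-wy) (sym y≡w)
        ... | inj₂ y≡x = x≢y (sym y≡x)

        -- This puts z among the disagreements, whence `w≤z`. If `l` were in `S`, it would equal
        -- `k`, so contain y and equal `e`.
        l∉S : ¬ l ∈ ⟦ S ⟧ₑ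
        l∉S l∈S with refl ← matching-unique matS l∈S k∈S z∈l (Joins⇒∈ʳ k-yz) =
          e∉S (subst ⟦ S ⟧ₑ (matching-unique matM l∈M e∈M y∈k (Joins⇒∈ʳ e-wy)) l∈S)

        w≤x : upper w ≤ upper x
        w≤x = w-min (disagrees⇒∈ f∈M f∉S x∈f)

        w≤y : upper w ≤ upper y
        w≤y = w-min (disagrees⇒∈ e∈M e∉S (Joins⇒∈ʳ e-wy))

        w≤x′ : upper w ≤ upper x′
        w≤x′ = w-min (disagrees⇒∈ f∈M f∉S (Joins⇒∈ʳ f-xx′))

        w≤z : upper w ≤ upper z
        w≤z = w-min (disagrees⇒∈ l∈M l∉S z∈l)

        w∈x : upper w ∈ I x
        w∈x = ~⇒lower≤upper (~-sym (Joins⇒~ g-wx)) , w≤x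

        w∈y : upper w ∈ I y
        w∈y = ~⇒lower≤upper (~-sym (Joins⇒~ e-wy)) , w≤y

        x≁z : ¬ x ~ z
        x≁z = strongIndependent⇒≁ g∈S k∈S g≢k g-wx k-yz w∈x w∈y w≤z

        x≢z : x ≢ z
        x≢z refl = matS g∈S k∈S g≢k (x , Joins⇒∈ʳ g-wx , Joins⇒∈ʳ k-yz)

        x≤z : upper x ≤ lower z
        x≤z with total (lower z) (upper x)
        ... | inj₁ z≤x = contradiction (lower≤upper⇒~ x≢z (≤-trans (proj₁ w∈x) w≤z) z≤x) x≁z
        ... | inj₂ x≤z = x≤z

        y≢x′ : y ≢ x′
        y≢x′ refl = matM e∈M f∈M e≢f (y , Joins⇒∈ʳ e-wy , Joins⇒∈ʳ f-xx′)

        y~x′ : y ~ x′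
        -- The chains are lower y ≤ upper w ≤ upper x′ and lower x′ ≤ upper x ≤ lower z ≤ upper y.
        y~x′ = lower≤upper⇒~ y≢x′ (≤-trans (proj₁ w∈y) w≤x′)
          (≤-trans (~⇒lower≤upper (~-sym (Joins⇒~ f-xx′)))
            (≤-trans x≤z (~⇒lower≤upper (~-sym (Joins⇒~ k-yz)))))

        x′≡z : ∃ (λ h → Joins h y x′) → x′ ≡ z
        x′≡z (h , h-yx′) =
          [ (λ x′≡y → contradiction (sym x′≡y) y≢x′) , id ]′ (ends-Joins k-yz x′∈k)
          where
          open Exchange M e f g h

          rival : IsRival exchange
          rival with ⊆M , M⊆ ← exchange-matched matM e∈M f∈M e≢f e-wy f-xx′ g-wx h-yx′ =
            exchange-matching matM e∈M f∈M e≢f e-wy f-xx′ g-wx h-yx′ , M⊆S ∘ ⊆M , M⊆ ∘ S⊆M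

          ∈-vs : ∀ {v} → v ≢ w → v ∈ˡ w ∷ vs → v ∈ˡ vs
          ∈-vs v≢w (here v≡w)   = contradiction v≡w v≢w
          ∈-vs v≢w (there v∈vs) = v∈vs

          h-ends : ∀ {v} → v ∈ endsOf h → v ∈ˡ vs
          h-ends v∈h with ends-Joins h-yx′ v∈h
          ... | inj₁ refl = ∈-vs (≢-sym (~⇒≢ (Joins⇒~ e-wy)))
            (disagrees⇒∈ e∈M e∉S (Joins⇒∈ʳ e-wy))
          ... | inj₂ refl = ∈-vs (λ { refl → w∉f (Joins⇒∈ʳ f-xx′) })
            (disagrees⇒∈ f∈M f∉S (Joins⇒∈ʳ f-xx′))

          -- At `w` the edge is now `g`, which is in `S`; `h` has both ends in `vs`; a kept edge
          -- avoids `w`, where `M` had `e`, so the old agreement covers it.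
          exchange-agrees : ∀ {v} → v ∉ˡ vs → AgreesAt exchange v
          exchange-agrees {v} v∉vs j∈ v∈j with ∈-exchange⁻ j∈
          ... | inj₁ refl        = g∈S
          ... | inj₂ (inj₁ refl) = contradiction (h-ends v∈j) v∉vs
          ... | inj₂ (inj₂ (j∈M , j≢e , _)) = agrees (v∉vs ∘ ∈-vs v≢w) j∈M v∈j
            where
            v≢w : v ≢ w
            v≢w refl = j≢e (matching-unique matM j∈M e∈M v∈j w∈e)

          x′∈k : x′ ∈ endsOf k
          x′∈k = subst (λ j → x′ ∈ endsOf j)
            (matching-unique matS (rec rival exchange-agrees (∈-exchange⁺ (inj₂ (inj₁ refl))))
              k∈S (Joins⇒∈ˡ h-yx′) y∈k)
            (Joins⇒∈ʳ h-yx′)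

    -- Induction on the list of possible disagreements, sorted by upper end: its head is settled by
    -- `leftmost-agrees`, with the claim for the tail as `rec`.
    rival-⊆ : ∀ {vs} → AllPairs (λ u v → upper u ≤ upper v) vs →
              ∀ {M} → IsRival M → (∀ {v} → v ∉ˡ vs → AgreesAt M v) → ⟦ M ⟧ₑ ⊆ ⟦ S ⟧ₑ
    rival-⊆ [] rival agrees e∈M = agrees (λ ()) e∈M (inj₁ refl)
    rival-⊆ {w ∷ vs} (w≤vs ∷ sorted) {M} rival agrees = rival-⊆ sorted rival agrees′
      where
      w-min : ∀ {v} → v ∈ˡ w ∷ vs → upper w ≤ upper v
      w-min (here refl)  = ≤-refl
      w-min (there v∈vs) = lookup w≤vs v∈vs

      agrees′ : ∀ {v} → v ∉ˡ vs → AgreesAt M v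
      agrees′ {v} v∉vs with v ≟ w
      ... | yes refl = leftmost-agrees w-min (rival-⊆ sorted) rival agrees
      ... | no v≢w   = agrees λ { (here v≡w) → v≢w v≡w ; (there v∈vs) → v∉vs v∈vs }

    strongIndependent⇒uniquelyRestricted : IsUniquelyRestrictedMatching S
    strongIndependent⇒uniquelyRestricted = strongIndependent⇒matching , λ M matM M≐S →
      matching-⊆⇒≗ strongIndependent⇒matching M≐S
        (rival-⊆ (Linked⇒AllPairs ≤-trans (sort-↗ vertices)) (matM , M≐S)
          -- The induction starts from all vertices, so agreement outside the list is vacuous.
          (λ v∉ → contradiction (∈-resp-↭ (↭-sym (sort-↭ vertices)) (∈-allFin _)) v∉))
      where
      open Sort (On.decTotalOrder O upper) using (sort-↭; sort-↗)
      vertices = allFin order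

theorem9 : ∀ {c ℓ₁ ℓ₂} (O : DecTotalOrder c ℓ₁ ℓ₂) (G : Graph)
    (R : IntervalRepresentation O G) (S : EdgeSet G) →
    IsStrongIndependent (edgeNestDigraph O R) ⟦ S ⟧ₑ ⇔ IsUniquelyRestrictedMatching S
theorem9 O G R S =
  mk⇔ (strongIndependent⇒uniquelyRestricted O R S) (uniquelyRestricted⇒strongIndependent O R)
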